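{- Let $\mathbb{V}$ be a vector space of dimension $n\ge 3$ over the field of $2$ elements, with basis $\{b_1,\dots,b_n\}$, and let $G(\mathbb{V})$ be its non-zero component graph. Let $u,v\in T_i$ for some $i$ with $1\le i\le n-1$. Then $$fix(u,v)=\{w\in S(G(\mathbb{V})): |S_w\cap S_u|\neq |S_w\cap S_v|\}.$$
   Context: The non-zero component graph $G(\mathbb{V})$ (with respect to the basis $\{b_1,\dots,b_n\}$) has as vertices the non-zero vectors of $\mathbb{V}$; two distinct vertices are adjacent iff some $b_j$ has non-zero coefficient in both of their expansions in the basis. The skeleton $S_u$ of a vertex $u$ is the set of basis vectors having non-zero coefficient in the expansion of $u$. $T_i=\{v\in V(G(\mathbb{V})): |S_v|=i\}$ for $1\le i\le n$. For a graph $G$, $\Gamma(G)$ is its automorphism group, $\Gamma_x(G)$ is the stabilizer of the vertex $x$, $\mathcal{O}(u)$ is the orbit of $u$ under $\Gamma(G)$, and $\mathcal{O}_x(u)=\{g(u): g\in\Gamma_x(G)\}$. $S(G)=\{v\in V(G): |\mathcal{O}(v)|\ge 2\}$. For $(u,v)\in S(G)\times S(G)$, the fixing neighborhood is $fix(u,v)=\{x\in S(G): \mathcal{O}_x(u)\ne\mathcal{O}_x(v)\}$ (with the convention $fix(u,v)=\emptyset$ for distinct $u,v$ with $\mathcal{O}(u)\neq\mathcal{O}(v)$). -}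

module Defs where

open import Algebra.Bundles using (CommutativeRing)
open import Algebra.Module.Bundles using (Module)
import Algebra.Properties.AbelianGroup as AbelianGroupProperties
import Algebra.Properties.CommutativeMonoid.Sum as CommutativeMonoidSum
open import Data.Bool.Properties using (xor-∧-commutativeRing) renaming (_≟_ to _≟ᵇ_)
open import Data.Fin.Base using (Fin)
open import Data.Fin.Subset using (Subset; ∣_∣)
open import Data.Nat.Base using (ℕ)
open import Data.Product.Base using (Σ; ∃-syntax; _×_; _,_; proj₁; proj₂)
open import Data.Vec.Base using (tabulate)
open import Data.Vec.Functional using (Vector)
open import Function.Base using (_∘_)
open import Function.Bundles using (Inverse; _⇔_)
open import Level using (Level; _⊔_; 0ℓ; suc)
open import Relation.Binary.Bundles using (Setoid)
open import Relation.Binary.Core using (Rel)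
open import Relation.Binary.Definitions using (Irreflexive; Symmetric; _Respects₂_)
import Relation.Binary.Construct.On as On
open import Relation.Binary.PropositionalEquality using (_≡_)
import Relation.Binary.Reasoning.Setoid as SetoidReasoning
open import Relation.Nullary using (¬_; does; ¬?)
open import Relation.Unary using (Pred; _∈_; _≐_)

private
  variable
    r ℓr m ℓm a ℓ e : Level

-- Undirected simple graphs.  Vertices form a setoid because the vectors of a
-- `Module` are only given up to its equality `_≈ᴹ_`.
record Graph a ℓ e : Set (suc (a ⊔ ℓ ⊔ e)) where
  field
    vertices   : Setoid a ℓ
  open Setoid vertices public using (_≈_; _≉_) renaming (Carrier to Vertex)
  field
    Adj        : Rel Vertex e
    adj-resp-≈ : Adj Respects₂ _≈_
    adj-sym    : Symmetric Adj
    adj-irrefl : Irreflexive _≈_ Adj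

module _ (G : Graph a ℓ e) where
  open Graph G

  record Automorphism : Set (a ⊔ ℓ ⊔ e) where
    field
      perm      : Inverse vertices vertices
    open Inverse perm public using (to; from)
    field
      preserves : ∀ x y → Adj x y ⇔ Adj (to x) (to y)

  open Automorphism using (to)

  Stabilizer : Vertex → Pred Automorphism ℓ
  Stabilizer x g = to g x ≈ x

  Orbit : Vertex → Pred Vertex (a ⊔ ℓ ⊔ e)
  Orbit u w = ∃[ g ] to g u ≈ w

  StabOrbit : Vertex → Vertex → Pred Vertex (a ⊔ ℓ ⊔ e)
  StabOrbit x u w = ∃[ g ] g ∈ Stabilizer x × to g u ≈ w

  -- |Orbit u| ≥ 2, expressed by two distinct members of the orbit.
  𝒮 : Pred Vertex (a ⊔ ℓ ⊔ e)
  𝒮 u = ∃[ w₁ ] ∃[ w₂ ] w₁ ∈ Orbit u × w₂ ∈ Orbit u × w₁ ≉ w₂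

  -- Usually defined only for u, v in 𝒮; the same formula is used here for all
  -- vertices.  The conjunct `Orbit u ≐ Orbit v` is the convention that the
  -- fixing neighborhood is empty when u and v lie in different orbits.
  fix : Vertex → Vertex → Pred Vertex (a ⊔ ℓ ⊔ e)
  fix u v x = x ∈ 𝒮 × Orbit u ≐ Orbit v × ¬ (StabOrbit x u ≐ StabOrbit x v)

module _ {R : CommutativeRing r ℓr} (V : Module R m ℓm) where
  open CommutativeRing R hiding (refl; sym; trans)
  open Module V
  open CommutativeMonoidSum +ᴹ-commutativeMonoid using (sum; sum-cong-≋; ∑-distrib-+; sum-replicate-zero)

  linComb : ∀ {n} → Vector Carrier n → Vector Carrierᴹ n → Carrierᴹ
  linComb c b = sum (λ j → c j *ₗ b j)

  record Basis (n : ℕ) : Set (r ⊔ ℓr ⊔ m ⊔ ℓm) where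
    field
      b           : Vector Carrierᴹ n
      spanning    : ∀ x → ∃[ c ] x ≈ᴹ linComb c b
      independent : ∀ c → linComb c b ≈ᴹ 0ᴹ → ∀ j → c j ≈ 0#

    coeff : Carrierᴹ → Vector Carrier n
    coeff x = proj₁ (spanning x)

    coeff-cong : ∀ {x y} → x ≈ᴹ y → ∀ j → coeff x j ≈ coeff y j
    coeff-cong {x} {y} x≈y j =
      AbelianGroupProperties.x∙y⁻¹≈ε⇒x≈y +-abelianGroup _ _ (independent (cx ⊖ cy) difference j)
      where
      open SetoidReasoning ≈ᴹ-setoid
      cx = coeff x
      cy = coeff y
      neg : Vector Carrier n → Vector Carrier n
      neg c k = - c k
      _⊖_ : Vector Carrier n → Vector Carrier n → Vector Carrier n
      (c ⊖ d) k = c k + - d k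
      linComb-⊖ : ∀ c d → linComb (c ⊖ d) b ≈ᴹ linComb c b +ᴹ linComb (neg d) b
      linComb-⊖ c d = begin
        linComb (c ⊖ d) b                     ≈⟨ sum-cong-≋ (λ k → *ₗ-distribʳ (b k) (c k) (- d k)) ⟩
        sum (λ k → c k *ₗ b k +ᴹ - d k *ₗ b k) ≈⟨ ∑-distrib-+ (λ k → c k *ₗ b k) (λ k → - d k *ₗ b k) ⟩
        linComb c b +ᴹ linComb (neg d) b       ∎
      difference : linComb (cx ⊖ cy) b ≈ᴹ 0ᴹ
      difference = begin
        linComb (cx ⊖ cy) b                ≈⟨ linComb-⊖ cx cy ⟩
        linComb cx b +ᴹ linComb (neg cy) b ≈⟨ +ᴹ-congʳ (≈ᴹ-sym (proj₂ (spanning x))) ⟩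
        x +ᴹ linComb (neg cy) b            ≈⟨ +ᴹ-congʳ x≈y ⟩
        y +ᴹ linComb (neg cy) b            ≈⟨ +ᴹ-congʳ (proj₂ (spanning y)) ⟩
        linComb cy b +ᴹ linComb (neg cy) b ≈⟨ ≈ᴹ-sym (linComb-⊖ cy cy) ⟩
        linComb (cy ⊖ cy) b                ≈⟨ sum-cong-≋ (λ k → *ₗ-congʳ (-‿inverseʳ (cy k))) ⟩
        sum (λ k → 0# *ₗ b k)              ≈⟨ sum-cong-≋ (λ k → *ₗ-zeroˡ (b k)) ⟩
        sum {n} (λ _ → 0ᴹ)                 ≈⟨ sum-replicate-zero n ⟩
        0ᴹ                                 ∎

module _ {R : CommutativeRing r ℓr} {V : Module R m ℓm} {n : ℕ} (B : Basis V n) where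
  open CommutativeRing R using (0#; trans) renaming (_≉_ to _≉ᴿ_)
  open Module V
  open Basis B

  NonZeroVector : Set (m ⊔ ℓm)
  NonZeroVector = Σ Carrierᴹ (_≉ᴹ 0ᴹ)

  nonZeroComponentGraph : Graph (m ⊔ ℓm) ℓm (ℓr ⊔ ℓm)
  nonZeroComponentGraph = record
    { vertices   = On.setoid {B = NonZeroVector} ≈ᴹ-setoid proj₁
    ; Adj        = λ (x , _) (y , _) →
                     x ≉ᴹ y × ∃[ j ] coeff x j ≉ᴿ 0# × coeff y j ≉ᴿ 0#
    ; adj-resp-≈ =
        (λ y≈z (x≉y , j , xj , yj) →
            (λ x≈z → x≉y (≈ᴹ-trans x≈z (≈ᴹ-sym y≈z)))
          , j , xj , yj ∘ trans (coeff-cong y≈z j))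
      , (λ y≈z (y≉x , j , yj , xj) →
            (λ z≈x → y≉x (≈ᴹ-trans y≈z z≈x))
          , j , yj ∘ trans (coeff-cong y≈z j) , xj)
    ; adj-sym    = λ (x≉y , j , xj , yj) → x≉y ∘ ≈ᴹ-sym , j , yj , xj
    ; adj-irrefl = λ x≈y (x≉y , _) → x≉y x≈y
    }

𝔽₂ : CommutativeRing 0ℓ 0ℓ
𝔽₂ = xor-∧-commutativeRing

module _ {V : Module 𝔽₂ m ℓm} {n : ℕ} (B : Basis V n) where
  open CommutativeRing 𝔽₂ using (0#)
  open Basis B

  -- Linear independence makes j ↦ b j injective, so the skeleton, a set of basis
  -- vectors, is represented by the set of their indices.
  skeleton : NonZeroVector B → Subset n
  skeleton (x , _) = tabulate (λ j → does (¬? (coeff x j ≟ᵇ 0#)))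

  T : ℕ → Pred (NonZeroVector B) 0ℓ
  T i x = ∣ skeleton x ∣ ≡ i

{-# OPTIONS --safe #-}

-- Every permutation of the basis induces an automorphism of the graph, and two pairs
-- of skeletons with the same sizes and the same intersection size differ by such a
-- permutation.  Conversely, an automorphism g preserves disjointness of skeletons.
-- Since S_x ⊆ S_y means that whatever is disjoint from y is disjoint from x, it also
-- preserves inclusion, so choosing σ j in the skeleton of g(b_j) gives a permutation σ
-- of the indices with S_{g x} = σ(S_x), and g preserves |S_x ∩ S_y|.
module Submission where

open import Defs
open import Algebra.Bundles using (CommutativeRing)
open import Algebra.Module.Bundles using (Module)
import Algebra.Properties.AbelianGroup as AbelianGroupProperties
import Algebra.Properties.CommutativeMonoid.Sum as CommutativeMonoidSum
open import Data.Bool.Base using (Bool; true; false; _∧_; if_then_else_)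
open import Data.Bool.Properties using () renaming (_≟_ to _≟ᵇ_)
open import Data.Fin.Base using (Fin; zero; suc; punchIn)
open import Data.Fin.Permutation
  using (Permutation′; permutation; insert; flip; inverseˡ; inverseʳ; _⟨$⟩ʳ_; _⟨$⟩ˡ_)
  renaming (id to idₚ)
open import Data.Fin.Properties using (¬∀⟶∃¬) renaming (_≟_ to _≟ᶠ_)
open import Data.Fin.Subset using (Subset; _∩_; ∣_∣)
open import Data.Fin.Subset.Properties using (∩-idem)
open import Data.Nat.Base using (ℕ; zero; suc; _+_; _≤_; _∸_)
open import Data.Nat.Properties
  using (+-suc; +-cancelˡ-≡; suc-injective; +-0-commutativeMonoid)
open import Data.Product.Base using (∃-syntax; _×_; _,_; proj₁; proj₂)
open import Data.Product.Properties using (≡-dec; ,-injective)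
open import Data.Vec.Base using (Vec; []; _∷_; lookup; zip; count; removeAt)
open import Data.Vec.Properties using (lookup∘tabulate; tabulate-cong; lookup-zip; lookup-zipWith)
open import Function.Base using (_∘_; id)
open import Function.Bundles using (Equivalence; Inverse; mk⇔)
import Function.Construct.Composition as Composition
import Function.Construct.Identity as Identity
import Function.Construct.Symmetry as Symmetry
open import Level using (Level)
open import Relation.Binary.Bundles using (Setoid)
open import Relation.Binary.Definitions using (DecidableEquality)
open import Relation.Binary.PropositionalEquality
  using (_≡_; _≢_; refl; sym; trans; cong; cong₂; subst; module ≡-Reasoning)
import Relation.Binary.Reasoning.Setoid as SetoidReasoning
open import Relation.Nullary using (¬_; ¬?; does; yes; no; contradiction)
open import Relation.Unary using (_∈_; _⊆_; _≐_)

private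
  variable
    r ℓr m ℓm a ℓ e : Level
    n : ℕ

-- Automorphism groups and orbits

module _ {G : Graph a ℓ e} where
  open Graph G
  open Automorphism
  private module S = Setoid vertices

  idᵃ : Automorphism G
  idᵃ = record
    { perm      = Identity.inverse vertices
    ; preserves = λ x y → mk⇔ id id
    }

  infixr 9 _∘ᵃ_

  _∘ᵃ_ : Automorphism G → Automorphism G → Automorphism G
  h ∘ᵃ g = record
    { perm      = Composition.inverse (perm g) (perm h)
    ; preserves = λ x y →
        Composition.equivalence (preserves g x y) (preserves h (to g x) (to g y))
    }

  to∘from : ∀ (g : Automorphism G) x → to g (from g x) ≈ x
  to∘from g x = Inverse.inverseˡ (perm g) S.refl

  from∘to : ∀ (g : Automorphism G) x → from g (to g x) ≈ x
  from∘to g x = Inverse.inverseʳ (perm g) S.refl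

  to-cong : ∀ (g : Automorphism G) {x y} → x ≈ y → to g x ≈ to g y
  to-cong g = Inverse.to-cong (perm g)

  from-cong : ∀ (g : Automorphism G) {x y} → x ≈ y → from g x ≈ from g y
  from-cong g = Inverse.from-cong (perm g)

  to-injective : ∀ (g : Automorphism G) {x y} → to g x ≈ to g y → x ≈ y
  to-injective g eq = S.trans (S.sym (from∘to g _)) (S.trans (from-cong g eq) (from∘to g _))

  infix 10 _⁻¹ᵃ

  _⁻¹ᵃ : Automorphism G → Automorphism G
  g ⁻¹ᵃ = record
    { perm      = Symmetry.inverse (perm g)
    ; preserves = λ x y → mk⇔
        (λ xy → Equivalence.from (preserves g (from g x) (from g y))
                  (resp (S.sym (to∘from g x)) (S.sym (to∘from g y)) xy))
        (λ xy → resp (to∘from g x) (to∘from g y)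
                  (Equivalence.to (preserves g (from g x) (from g y)) xy))
    }
    where
    resp : ∀ {x x′ y y′} → x ≈ x′ → y ≈ y′ → Adj x y → Adj x′ y′
    resp x≈x′ y≈y′ = proj₂ adj-resp-≈ x≈x′ ∘ proj₁ adj-resp-≈ y≈y′

  to⇒from : ∀ (g : Automorphism G) {x y} → to g x ≈ y → from g y ≈ x
  to⇒from g gx≈y = S.trans (from-cong g (S.sym gx≈y)) (from∘to g _)

  -- Precomposing with `g` turns an automorphism carrying `v` to `w` into one carrying `u` to `w`.
  Orbit-⊆ : ∀ (g : Automorphism G) {u v} → to g u ≈ v → Orbit G v ⊆ Orbit G u
  Orbit-⊆ g gu≈v (h , hv≈w) = h ∘ᵃ g , S.trans (to-cong h gu≈v) hv≈w

  Orbit-≐ : ∀ (g : Automorphism G) {u v} → to g u ≈ v → Orbit G u ≐ Orbit G v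
  Orbit-≐ g gu≈v = Orbit-⊆ (g ⁻¹ᵃ) (to⇒from g gu≈v) , Orbit-⊆ g gu≈v

  StabOrbit-⊆ : ∀ (g : Automorphism G) {x u v} → to g x ≈ x → to g u ≈ v →
    StabOrbit G x v ⊆ StabOrbit G x u
  StabOrbit-⊆ g gx≈x gu≈v (h , hx≈x , hv≈w) =
    h ∘ᵃ g , S.trans (to-cong h gx≈x) hx≈x , S.trans (to-cong h gu≈v) hv≈w

  StabOrbit-≐ : ∀ (g : Automorphism G) {x u v} → to g x ≈ x → to g u ≈ v →
    StabOrbit G x u ≐ StabOrbit G x v
  StabOrbit-≐ g gx≈x gu≈v =
    StabOrbit-⊆ (g ⁻¹ᵃ) (to⇒from g gx≈x) (to⇒from g gu≈v) , StabOrbit-⊆ g gx≈x gu≈v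

  StabOrbit-refl : ∀ x u → u ∈ StabOrbit G x u
  StabOrbit-refl x u = idᵃ , S.refl , S.refl

-- Counting

-- Matches the value of `insert zero k π` at `suc i`, which is `punchIn k (π ⟨$⟩ʳ i)`.
lookup-punchIn : ∀ {A : Set a} (xs : Vec A (suc n)) i j →
  lookup xs (punchIn i j) ≡ lookup (removeAt xs i) j
lookup-punchIn (x ∷ xs)         zero    j       = refl
lookup-punchIn (x ∷ xs@(_ ∷ _)) (suc i) zero    = refl
lookup-punchIn (x ∷ xs@(_ ∷ _)) (suc i) (suc j) = lookup-punchIn xs i j

module _ {A : Set a} (_≟_ : DecidableEquality A) where

  count-suc⇒lookup : ∀ x (xs : Vec A n) {k} → count (_≟ x) xs ≡ suc k → ∃[ i ] lookup xs i ≡ x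
  count-suc⇒lookup x (y ∷ xs) eq with y ≟ x
  ... | yes y≡x = zero , y≡x
  ... | no  _   = let i , xsᵢ≡x = count-suc⇒lookup x xs eq in suc i , xsᵢ≡x

  count-removeAt : ∀ x (xs : Vec A (suc n)) i →
    count (_≟ x) xs ≡ count (_≟ x) (lookup xs i ∷ removeAt xs i)
  count-removeAt x (y ∷ xs)         zero    = refl
  count-removeAt x (y ∷ xs@(_ ∷ _)) (suc i)
    with does (y ≟ x) | does (lookup xs i ≟ x) | count-removeAt x xs i
  ... | true  | true  | eq = cong suc eq
  ... | true  | false | eq = cong suc eq
  ... | false | true  | eq = eq
  ... | false | false | eq = eq

  count-∷-cancel : ∀ x y (xs ys : Vec A n) →
    count (_≟ x) (y ∷ xs) ≡ count (_≟ x) (y ∷ ys) → count (_≟ x) xs ≡ count (_≟ x) ys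
  count-∷-cancel x y xs ys eq with does (y ≟ x)
  ... | true  = suc-injective eq
  ... | false = eq

  count-∷-refl : ∀ x (xs : Vec A n) → count (_≟ x) (x ∷ xs) ≡ suc (count (_≟ x) xs)
  count-∷-refl x xs with x ≟ x
  ... | yes _   = refl
  ... | no  x≢x = contradiction refl x≢x

  -- Induction on `xs`: the head has positive count in `ys`, so it occurs there at some `k`.
  -- Deleting both occurrences keeps all counts equal, and the permutation of the rest is extended
  -- by sending `zero` to `k`.
  count≡⇒permutation : (xs ys : Vec A n) → (∀ x → count (_≟ x) xs ≡ count (_≟ x) ys) →
    ∃[ π ] ∀ i → lookup xs i ≡ lookup ys (π ⟨$⟩ʳ i)
  count≡⇒permutation []       []         eq = idₚ , λ ()
  count≡⇒permutation (x ∷ xs) ys@(_ ∷ _) eq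
    with k , refl ← count-suc⇒lookup x ys (trans (sym (eq x)) (count-∷-refl x xs))
    with π , π-ok ← count≡⇒permutation xs (removeAt ys k)
           (λ z → count-∷-cancel z x xs (removeAt ys k) (trans (eq z) (count-removeAt z ys k)))
    = insert zero k π , λ where
        zero    → refl
        (suc i) → trans (π-ok i) (sym (lookup-punchIn ys k (π ⟨$⟩ʳ i)))

_≟²_ : DecidableEquality (Bool × Bool)
_≟²_ = ≡-dec _≟ᵇ_ _≟ᵇ_

-- The size of one of the four Venn regions of `p` and `q`; for instance `(true , false)` selects
-- the part of `p` outside `q`.
count² : Bool × Bool → Subset n → Subset n → ℕ
count² s p q = count (_≟² s) (zip p q)

∣p∩q∣≡count² : (p q : Subset n) → ∣ p ∩ q ∣ ≡ count² (true , true) p q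
∣p∩q∣≡count² []          []          = refl
∣p∩q∣≡count² (true  ∷ p) (true  ∷ q) = cong suc (∣p∩q∣≡count² p q)
∣p∩q∣≡count² (true  ∷ p) (false ∷ q) = ∣p∩q∣≡count² p q
∣p∩q∣≡count² (false ∷ p) (true  ∷ q) = ∣p∩q∣≡count² p q
∣p∩q∣≡count² (false ∷ p) (false ∷ q) = ∣p∩q∣≡count² p q

∣p∣≡∣p∩q∣+count² : (p q : Subset n) → ∣ p ∣ ≡ ∣ p ∩ q ∣ + count² (true , false) p q
∣p∣≡∣p∩q∣+count² []          []          = refl
∣p∣≡∣p∩q∣+count² (true  ∷ p) (true  ∷ q) = cong suc (∣p∣≡∣p∩q∣+count² p q)
∣p∣≡∣p∩q∣+count² (true  ∷ p) (false ∷ q) = trans (cong suc (∣p∣≡∣p∩q∣+count² p q)) (sym (+-suc _ _))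
∣p∣≡∣p∩q∣+count² (false ∷ p) (true  ∷ q) = ∣p∣≡∣p∩q∣+count² p q
∣p∣≡∣p∩q∣+count² (false ∷ p) (false ∷ q) = ∣p∣≡∣p∩q∣+count² p q

∣q∣≡∣p∩q∣+count² : (p q : Subset n) → ∣ q ∣ ≡ ∣ p ∩ q ∣ + count² (false , true) p q
∣q∣≡∣p∩q∣+count² []          []          = refl
∣q∣≡∣p∩q∣+count² (true  ∷ p) (true  ∷ q) = cong suc (∣q∣≡∣p∩q∣+count² p q)
∣q∣≡∣p∩q∣+count² (true  ∷ p) (false ∷ q) = ∣q∣≡∣p∩q∣+count² p q
∣q∣≡∣p∩q∣+count² (false ∷ p) (true  ∷ q) = trans (cong suc (∣q∣≡∣p∩q∣+count² p q)) (sym (+-suc _ _))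
∣q∣≡∣p∩q∣+count² (false ∷ p) (false ∷ q) = ∣q∣≡∣p∩q∣+count² p q

n≡∣p∣+count² : (p q : Subset n) →
  n ≡ ∣ p ∣ + (count² (false , true) p q + count² (false , false) p q)
n≡∣p∣+count² []          []          = refl
n≡∣p∣+count² (true  ∷ p) (true  ∷ q) = cong suc (n≡∣p∣+count² p q)
n≡∣p∣+count² (true  ∷ p) (false ∷ q) = cong suc (n≡∣p∣+count² p q)
n≡∣p∣+count² (false ∷ p) (true  ∷ q) = trans (cong suc (n≡∣p∣+count² p q)) (sym (+-suc _ _))
-- The new index lies outside both sets, so the successor moves past two summands to reach the last
-- one.
n≡∣p∣+count² (false ∷ p) (false ∷ q) =
  trans (cong suc (n≡∣p∣+count² p q))
    (trans (sym (+-suc ∣ p ∣ _)) (cong (∣ p ∣ +_) (sym (+-suc _ _))))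

+-determinesʳ : ∀ {a a′ b b′ c c′} → a ≡ b + c → a′ ≡ b′ + c′ → a ≡ a′ → b ≡ b′ → c ≡ c′
+-determinesʳ {b = b} a≡b+c a′≡b′+c′ refl refl = +-cancelˡ-≡ b _ _ (trans (sym a≡b+c) a′≡b′+c′)

-- The two sizes, the intersection size and `n` determine the sizes of all four Venn regions, and a
-- permutation can match the regions one by one.
∣∣≡⇒permutation : (p q p′ q′ : Subset n) →
  ∣ p ∣ ≡ ∣ p′ ∣ → ∣ q ∣ ≡ ∣ q′ ∣ → ∣ p ∩ q ∣ ≡ ∣ p′ ∩ q′ ∣ →
  ∃[ π ] (∀ i → lookup p i ≡ lookup p′ (π ⟨$⟩ʳ i)) × (∀ i → lookup q i ≡ lookup q′ (π ⟨$⟩ʳ i))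
∣∣≡⇒permutation p q p′ q′ ∣p∣≡ ∣q∣≡ ∣p∩q∣≡ =
  π , (λ i → proj₁ (components i)) , (λ i → proj₂ (components i))
  where
  ft≡ : count² (false , true) p q ≡ count² (false , true) p′ q′
  ft≡ = +-determinesʳ (∣q∣≡∣p∩q∣+count² p q) (∣q∣≡∣p∩q∣+count² p′ q′) ∣q∣≡ ∣p∩q∣≡

  count²≡ : ∀ s → count² s p q ≡ count² s p′ q′
  count²≡ (true  , true)  = trans (sym (∣p∩q∣≡count² p q)) (trans ∣p∩q∣≡ (∣p∩q∣≡count² p′ q′))
  count²≡ (true  , false) =
    +-determinesʳ (∣p∣≡∣p∩q∣+count² p q) (∣p∣≡∣p∩q∣+count² p′ q′) ∣p∣≡ ∣p∩q∣≡
  count²≡ (false , true)  = ft≡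
  -- Cancelling `∣ p ∣` from `n` compares the complements of `p` and `p′`; cancelling the parts
  -- inside `q` and `q′` leaves what is outside both sets.
  count²≡ (false , false) =
    +-determinesʳ refl refl
      (+-determinesʳ (n≡∣p∣+count² p q) (n≡∣p∣+count² p′ q′) refl ∣p∣≡) ft≡

  matching = count≡⇒permutation _≟²_ (zip p q) (zip p′ q′) count²≡
  π        = proj₁ matching

  components : ∀ i → lookup p i ≡ lookup p′ (π ⟨$⟩ʳ i) × lookup q i ≡ lookup q′ (π ⟨$⟩ʳ i)
  components i = ,-injective
    (trans (sym (lookup-zip i p q)) (trans (proj₂ matching i) (lookup-zip (π ⟨$⟩ʳ i) p′ q′)))

open CommutativeMonoidSum +-0-commutativeMonoid using (sum; sum-permute; sum-cong-≗)

indicator : Bool → ℕ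
indicator s = if s then 1 else 0

∣p∣≡sum : (p : Subset n) → ∣ p ∣ ≡ sum (λ i → indicator (lookup p i))
∣p∣≡sum []          = refl
∣p∣≡sum (true  ∷ p) = cong suc (∣p∣≡sum p)
∣p∣≡sum (false ∷ p) = ∣p∣≡sum p

-- Cardinality is a sum of indicators, and a finite sum is invariant under reindexing.
∣∣-permute : (π : Permutation′ n) (p q : Subset n) →
  (∀ i → lookup p (π ⟨$⟩ʳ i) ≡ lookup q i) → ∣ p ∣ ≡ ∣ q ∣
∣∣-permute π p q eq = begin
  ∣ p ∣                                        ≡⟨ ∣p∣≡sum p ⟩
  sum (λ i → indicator (lookup p i))           ≡⟨ sum-permute (λ i → indicator (lookup p i)) π ⟩
  sum (λ i → indicator (lookup p (π ⟨$⟩ʳ i)))  ≡⟨ sum-cong-≗ (λ i → cong indicator (eq i)) ⟩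
  sum (λ i → indicator (lookup q i))           ≡⟨ ∣p∣≡sum q ⟨
  ∣ q ∣                                        ∎
  where open ≡-Reasoning

-- Coordinates and automorphisms induced by permutations of the basis

module _ {R : CommutativeRing r ℓr} {V : Module R m ℓm} (B : Basis V n) where
  private
    module R = CommutativeRing R
    G = nonZeroComponentGraph B
  open R using (Carrier; 0#; -_)
  open Module V
  open Basis B
  open CommutativeMonoidSum +ᴹ-commutativeMonoid
    using () renaming (sum to sumᴹ; sum-cong-≋ to sumᴹ-cong; ∑-distrib-+ to ∑ᴹ-distrib-+;
                       sum-replicate-zero to sumᴹ-zero)

  linComb-cong : ∀ {c d : Fin n → Carrier} → (∀ j → c j R.≈ d j) → linComb V c b ≈ᴹ linComb V d b
  linComb-cong c≈d = sumᴹ-cong (λ j → *ₗ-congʳ (c≈d j))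

  linComb-+ : ∀ c d → linComb V (λ j → c j R.+ d j) b ≈ᴹ linComb V c b +ᴹ linComb V d b
  linComb-+ c d = ≈ᴹ-trans
    (sumᴹ-cong (λ j → *ₗ-distribʳ (b j) (c j) (d j)))
    (∑ᴹ-distrib-+ (λ j → c j *ₗ b j) (λ j → d j *ₗ b j))

  linComb-injective : ∀ c d → linComb V c b ≈ᴹ linComb V d b → ∀ j → c j R.≈ d j
  linComb-injective c d eq j =
    AbelianGroupProperties.x∙y⁻¹≈ε⇒x≈y R.+-abelianGroup _ _ (independent (c ⊖ d) difference j)
    where
    open SetoidReasoning ≈ᴹ-setoid
    _⊖_ : (Fin n → Carrier) → (Fin n → Carrier) → Fin n → Carrier
    (c ⊖ d) k = c k R.+ - d k
    difference : linComb V (c ⊖ d) b ≈ᴹ 0ᴹ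
    difference = begin
      linComb V (c ⊖ d) b                         ≈⟨ linComb-+ c (λ k → - d k) ⟩
      linComb V c b +ᴹ linComb V (λ k → - d k) b  ≈⟨ +ᴹ-congʳ eq ⟩
      linComb V d b +ᴹ linComb V (λ k → - d k) b  ≈⟨ linComb-+ d (λ k → - d k) ⟨
      linComb V (d ⊖ d) b                         ≈⟨ linComb-cong (λ k → R.-‿inverseʳ (d k)) ⟩
      linComb V (λ _ → 0#) b                      ≈⟨ sumᴹ-cong (λ k → *ₗ-zeroˡ (b k)) ⟩
      sumᴹ {n} (λ _ → 0ᴹ)                         ≈⟨ sumᴹ-zero n ⟩
      0ᴹ                                          ∎

  -- `spanning` only supplies some coefficients; independence forces them to be `c`.
  coeff-linComb : ∀ c j → coeff (linComb V c b) j R.≈ c j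
  coeff-linComb c = linComb-injective _ c (≈ᴹ-sym (proj₂ (spanning _)))

  coeff-injective : ∀ {x y} → (∀ j → coeff x j R.≈ coeff y j) → x ≈ᴹ y
  coeff-injective {x} {y} eq =
    ≈ᴹ-trans (proj₂ (spanning x)) (≈ᴹ-trans (linComb-cong eq) (≈ᴹ-sym (proj₂ (spanning y))))

  coeff-0ᴹ : ∀ j → coeff 0ᴹ j R.≈ 0#
  coeff-0ᴹ = independent _ (≈ᴹ-sym (proj₂ (spanning 0ᴹ)))

  coeff≈0⇒≈0ᴹ : ∀ {x} → (∀ j → coeff x j R.≈ 0#) → x ≈ᴹ 0ᴹ
  coeff≈0⇒≈0ᴹ eq = coeff-injective (λ j → R.trans (eq j) (R.sym (coeff-0ᴹ j)))

  coeff-≡ : ∀ x {j k} → j ≡ k → coeff x j R.≈ coeff x k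
  coeff-≡ x refl = R.refl

  -- The linear map sending each `b j` to `b (π ⟨$⟩ʳ j)`, which is why the coefficients are read
  -- through the inverse of `π`.
  permute : Permutation′ n → NonZeroVector B → NonZeroVector B
  permute π (x , x≉0) = linComb V (λ j → coeff x (π ⟨$⟩ˡ j)) b , λ eq → x≉0 (coeff≈0⇒≈0ᴹ
    (λ j → R.trans (coeff-≡ x (sym (inverseˡ π))) (independent _ eq (π ⟨$⟩ʳ j))))

  coeff-permute : ∀ π x j → coeff (proj₁ (permute π x)) j R.≈ coeff (proj₁ x) (π ⟨$⟩ˡ j)
  coeff-permute π (x , _) = coeff-linComb (λ j → coeff x (π ⟨$⟩ˡ j))

  coeff-permute-⟨$⟩ʳ : ∀ π x j → coeff (proj₁ (permute π x)) (π ⟨$⟩ʳ j) R.≈ coeff (proj₁ x) j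
  coeff-permute-⟨$⟩ʳ π x j =
    R.trans (coeff-permute π x (π ⟨$⟩ʳ j)) (coeff-≡ (proj₁ x) (inverseˡ π))

  open Graph G using (_≈_)

  permute-≈ : ∀ π x y →
    (∀ j → coeff (proj₁ x) j R.≈ coeff (proj₁ y) (π ⟨$⟩ʳ j)) → permute π x ≈ y
  permute-≈ π x y eq = coeff-injective (λ j →
    R.trans (coeff-permute π x j)
      (R.trans (eq (π ⟨$⟩ˡ j)) (coeff-≡ (proj₁ y) (inverseʳ π))))

  permute-cong : ∀ π {x y} → x ≈ y → permute π x ≈ permute π y
  permute-cong π {x} {y} x≈y = permute-≈ π x (permute π y) (λ j →
    R.trans (coeff-cong x≈y j) (R.sym (coeff-permute-⟨$⟩ʳ π y j)))

  -- Has the shape of the `inverse` field of `Inverse`; with `flip π` for `π` it gives the other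
  -- half.
  permute-inverse : ∀ π {x y} → y ≈ permute (flip π) x → permute π y ≈ x
  permute-inverse π {x} {y} eq = permute-≈ π y x (λ j →
    R.trans (coeff-cong eq j) (coeff-permute (flip π) x j))

  permute-automorphism : Permutation′ n → Automorphism G
  permute-automorphism π = record
    { perm = record
        { to        = permute π
        ; from      = permute (flip π)
        ; to-cong   = λ {x} {y} → permute-cong π {x} {y}
        ; from-cong = λ {x} {y} → permute-cong (flip π) {x} {y}
        ; inverse   = (λ {x} {y} → permute-inverse π {x} {y})
                    , (λ {x} {y} → permute-inverse (flip π) {x} {y})
        }
    ; preserves = λ x y → mk⇔
        (λ (x≉y , j , xj , yj) →
            -- If the images coincide, `permute (flip π)` takes `permute π x` both to `x` and to
            -- `y`.
            (λ eq → x≉y (≈ᴹ-trans (≈ᴹ-sym (permute-inverse (flip π) {x} {permute π x} ≈ᴹ-refl))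
                                  (permute-inverse (flip π) {y} {permute π x} eq)))
          , π ⟨$⟩ʳ j
          , xj ∘ R.trans (R.sym (coeff-permute-⟨$⟩ʳ π x j))
          , yj ∘ R.trans (R.sym (coeff-permute-⟨$⟩ʳ π y j)))
        (λ (πx≉πy , j , xj , yj) →
            (λ eq → πx≉πy (permute-cong π {x} {y} eq))
          , π ⟨$⟩ˡ j
          , xj ∘ R.trans (coeff-permute π x j)
          , yj ∘ R.trans (coeff-permute π y j))
    }

-- Rigidity of automorphisms over the field of two elements

-- Over two elements a scalar is determined by whether it is non-zero, so a vector is determined by
-- its skeleton.
≢false-⇔⇒≡ : ∀ {s t : Bool} → (s ≢ false → t ≢ false) → (t ≢ false → s ≢ false) → s ≡ t
≢false-⇔⇒≡ {true}  {true}  f g = refl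
≢false-⇔⇒≡ {true}  {false} f g = contradiction refl (f λ ())
≢false-⇔⇒≡ {false} {true}  f g = contradiction refl (g λ ())
≢false-⇔⇒≡ {false} {false} f g = refl

module _ {V : Module 𝔽₂ m ℓm} (B : Basis V n) where
  open Module V
  open Basis B
  private
    G = nonZeroComponentGraph B
  open Graph G using (Vertex; _≈_)
  open Automorphism

  -- Phrased as non-vanishing, the form in which `Adj` gives and takes its common index.
  _∈ˢ_ : Fin n → Vertex → Set
  j ∈ˢ (x , _) = coeff x j ≢ false

  _⊆ˢ_ : Vertex → Vertex → Set
  x ⊆ˢ y = ∀ j → j ∈ˢ x → j ∈ˢ y

  Disjoint : Vertex → Vertex → Set
  Disjoint x y = ∀ j → j ∈ˢ x → ¬ (j ∈ˢ y)

  ∈ˢ-resp-≈ : ∀ x y → x ≈ y → x ⊆ˢ y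
  ∈ˢ-resp-≈ x y x≈y j j∈x yj≡0 = j∈x (trans (coeff-cong x≈y j) yj≡0)

  ∈ˢ-nonempty : ∀ x → ∃[ j ] j ∈ˢ x
  ∈ˢ-nonempty (x , x≉0) =
    ¬∀⟶∃¬ n _ (λ j → coeff x j ≟ᵇ false) (x≉0 ∘ coeff≈0⇒≈0ᴹ B)

  lookup-skeleton : ∀ x j → lookup (skeleton B x) j ≡ coeff (proj₁ x) j
  lookup-skeleton (x , _) j = trans (lookup∘tabulate _ j) (does-≢false (coeff x j))
    where
    does-≢false : ∀ s → does (¬? (s ≟ᵇ false)) ≡ s
    does-≢false true  = refl
    does-≢false false = refl

  basisVector : Fin n → Vertex
  basisVector j = linComb V (λ k → does (j ≟ᶠ k)) b , λ eq → j≟j≢false (independent _ eq j)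
    where
    j≟j≢false : does (j ≟ᶠ j) ≢ false
    j≟j≢false eq with j ≟ᶠ j
    ... | no j≢j = j≢j refl

  ∈ˢ-basisVector⁻ : ∀ j k → k ∈ˢ basisVector j → j ≡ k
  ∈ˢ-basisVector⁻ j k k∈ with j ≟ᶠ k in eq
  ... | yes j≡k = j≡k
  ... | no  _   = contradiction (trans (coeff-linComb B _ k) (cong does eq)) k∈

  -- Some index lies in the skeleton of a non-zero vector, and here it can only be `j`.
  ∈ˢ-basisVector : ∀ j → j ∈ˢ basisVector j
  ∈ˢ-basisVector j with k , k∈ ← ∈ˢ-nonempty (basisVector j)
                   with refl ← ∈ˢ-basisVector⁻ j k k∈ = k∈

  module _ (g : Automorphism G) where

    -- Vertices with disjoint skeletons are neither equal nor adjacent, and `g` preserves both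
    -- facts. Images sharing an index `j` would have to be equal or adjacent; in place of a case
    -- split, `to g x ≈ to g y` and its negation are both refuted.
    to-Disjoint : ∀ x y → Disjoint x y → Disjoint (to g x) (to g y)
    to-Disjoint x y x∥y j j∈gx j∈gy = ¬gx≉gy gx≉gy
      where
      ¬gx≉gy : ¬ ¬ (to g x ≈ to g y)
      ¬gx≉gy gx≉gy =
        let _ , k , k∈x , k∈y = Equivalence.from (preserves g x y) (gx≉gy , j , j∈gx , j∈gy)
        in x∥y k k∈x k∈y
      gx≉gy : ¬ (to g x ≈ to g y)
      gx≉gy gx≈gy =
        let k , k∈x = ∈ˢ-nonempty x
        in x∥y k k∈x (∈ˢ-resp-≈ x y (to-injective g {x} {y} gx≈gy) k k∈x)

  -- If `j` were in the skeleton of `to g x` but not of `to g y`, then the preimage of the `j`-th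
  -- basis vector would be disjoint from `y`, hence from `x`; applying `g` would make that basis
  -- vector disjoint from `to g x`.
  to-⊆ˢ : ∀ (g : Automorphism G) x y → x ⊆ˢ y → to g x ⊆ˢ to g y
  to-⊆ˢ g x y x⊆y j j∈gx gyj≡0 =
    to-Disjoint g bⱼ′ x bⱼ′∥x j
      (∈ˢ-resp-≈ bⱼ (to g bⱼ′) (≈ᴹ-sym (to∘from g bⱼ)) j (∈ˢ-basisVector j)) j∈gx
    where
    bⱼ = basisVector j
    bⱼ′ = from g bⱼ
    bⱼ∥gy : Disjoint bⱼ (to g y)
    bⱼ∥gy k k∈bⱼ k∈gy with refl ← ∈ˢ-basisVector⁻ j k k∈bⱼ = k∈gy gyj≡0
    bⱼ′∥x : Disjoint bⱼ′ x
    bⱼ′∥x k k∈bⱼ′ k∈x = to-Disjoint (g ⁻¹ᵃ) bⱼ (to g y) bⱼ∥gy k k∈bⱼ′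
      (∈ˢ-resp-≈ y (from g (to g y)) (≈ᴹ-sym (from∘to g y)) k (x⊆y k k∈x))

  -- An index picked from a non-empty skeleton; bijectivity comes afterwards, from `image-inverse`.
  image : Automorphism G → Fin n → Fin n
  image g j = proj₁ (∈ˢ-nonempty (to g (basisVector j)))

  image-∈ˢ : ∀ (g : Automorphism G) x j → j ∈ˢ x → image g j ∈ˢ to g x
  image-∈ˢ g x j j∈x =
    to-⊆ˢ g (basisVector j) x bⱼ⊆x (image g j) (proj₂ (∈ˢ-nonempty (to g (basisVector j))))
    where
    bⱼ⊆x : basisVector j ⊆ˢ x
    bⱼ⊆x k k∈bⱼ with refl ← ∈ˢ-basisVector⁻ j k k∈bⱼ = j∈x

  -- Following `j` by `g` and then by its inverse lands in the skeleton of the `j`-th basis vector,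
  -- whose only index is `j`.
  image-inverse : ∀ (g : Automorphism G) j → image (g ⁻¹ᵃ) (image g j) ≡ j
  image-inverse g j = sym (∈ˢ-basisVector⁻ j _
    (∈ˢ-resp-≈ (from g (to g bⱼ)) bⱼ (from∘to g bⱼ) _
      (image-∈ˢ (g ⁻¹ᵃ) (to g bⱼ) (image g j) (image-∈ˢ g bⱼ j (∈ˢ-basisVector j)))))
    where
    bⱼ = basisVector j

  image-permutation : Automorphism G → Permutation′ n
  image-permutation g =
    -- Inverting `g` twice gives back the same `image` by computation, so one lemma serves both
    -- sides.
    permutation (image g) (image (g ⁻¹ᵃ)) (image-inverse (g ⁻¹ᵃ)) (image-inverse g)

  -- One implication is `image-∈ˢ` for `g`; the other is `image-∈ˢ` for the inverse, moved back to
  -- `x` and `j`.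
  coeff-image : ∀ (g : Automorphism G) x j → coeff (proj₁ (to g x)) (image g j) ≡ coeff (proj₁ x) j
  coeff-image g x j = ≢false-⇔⇒≡
    (λ σj∈gx → ∈ˢ-resp-≈ (from g (to g x)) x (from∘to g x) j
      (subst (_∈ˢ from g (to g x)) (image-inverse g j)
        (image-∈ˢ (g ⁻¹ᵃ) (to g x) (image g j) σj∈gx)))
    (image-∈ˢ g x j)

  lookup-∩-skeleton : ∀ x y j →
    lookup (skeleton B x ∩ skeleton B y) j ≡ coeff (proj₁ x) j ∧ coeff (proj₁ y) j
  lookup-∩-skeleton x y j = trans (lookup-zipWith _∧_ j (skeleton B x) (skeleton B y))
    (cong₂ _∧_ (lookup-skeleton x j) (lookup-skeleton y j))

  skeleton-cong : ∀ {x y} → x ≈ y → skeleton B x ≡ skeleton B y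
  skeleton-cong x≈y = tabulate-cong (λ j → cong (λ s → does (¬? (s ≟ᵇ false))) (coeff-cong x≈y j))

  ∣∩∣-invariant : ∀ (g : Automorphism G) x y →
    ∣ skeleton B (to g x) ∩ skeleton B (to g y) ∣ ≡ ∣ skeleton B x ∩ skeleton B y ∣
  ∣∩∣-invariant g x y = ∣∣-permute (image-permutation g)
    (skeleton B (to g x) ∩ skeleton B (to g y)) (skeleton B x ∩ skeleton B y) (λ j →
    trans (lookup-∩-skeleton (to g x) (to g y) (image g j))
      (trans (cong₂ _∧_ (coeff-image g x j) (coeff-image g y j))
        (sym (lookup-∩-skeleton x y j))))

  -- A permutation matching the skeletons matches the coefficients themselves, so the induced
  -- automorphism carries `x` to `x′` and `y` to `y′` at once.
  ∣∩∣≡⇒automorphism : ∀ x y x′ y′ →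
    ∣ skeleton B x ∣ ≡ ∣ skeleton B x′ ∣ → ∣ skeleton B y ∣ ≡ ∣ skeleton B y′ ∣ →
    ∣ skeleton B x ∩ skeleton B y ∣ ≡ ∣ skeleton B x′ ∩ skeleton B y′ ∣ →
    ∃[ g ] to g x ≈ x′ × to g y ≈ y′
  ∣∩∣≡⇒automorphism x y x′ y′ ∣x∣≡ ∣y∣≡ ∣x∩y∣≡ =
    let π , x≡x′ , y≡y′ = ∣∣≡⇒permutation
          (skeleton B x) (skeleton B y) (skeleton B x′) (skeleton B y′) ∣x∣≡ ∣y∣≡ ∣x∩y∣≡
    in permute-automorphism B π , permute-≈ B π x x′ (coeffs x x′ π x≡x′)
                                , permute-≈ B π y y′ (coeffs y y′ π y≡y′)
    where
    coeffs : ∀ z z′ (π : Permutation′ n) →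
      (∀ j → lookup (skeleton B z) j ≡ lookup (skeleton B z′) (π ⟨$⟩ʳ j)) →
      ∀ j → coeff (proj₁ z) j ≡ coeff (proj₁ z′) (π ⟨$⟩ʳ j)
    coeffs z z′ π eq j =
      trans (sym (lookup-skeleton z j)) (trans (eq j) (lookup-skeleton z′ (π ⟨$⟩ʳ j)))

-- The fixing neighborhood in terms of intersection sizes

theorem3p2 : ∀ {m ℓm : Level} (V : Module 𝔽₂ m ℓm) (n : ℕ) → 3 ≤ n → (B : Basis V n) →
    ∀ (i : ℕ) → 1 ≤ i → i ≤ n ∸ 1 →
    ∀ (u v : NonZeroVector B) → u ∈ T B i → v ∈ T B i →
    fix (nonZeroComponentGraph B) u v
    ≐ (λ w → w ∈ 𝒮 (nonZeroComponentGraph B)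
    × ∣ skeleton B w ∩ skeleton B u ∣ ≢ ∣ skeleton B w ∩ skeleton B v ∣)
theorem3p2 V n _ B i _ _ u v u∈Tᵢ v∈Tᵢ =
    (λ {w} (w∈𝒮 , _ , orbits≢) → w∈𝒮 , λ ∣w∩u∣≡∣w∩v∣ →
      -- Comparing the pair `w`, `u` with the pair `w`, `v` gives an automorphism that fixes `w`.
      let g , gw≈w , gu≈v = ∣∩∣≡⇒automorphism B w u w v refl ∣u∣≡∣v∣ ∣w∩u∣≡∣w∩v∣
      in orbits≢ (StabOrbit-≐ g {w} {u} {v} gw≈w gu≈v))
  , (λ {w} (w∈𝒮 , ∣w∩u∣≢∣w∩v∣) →
      -- The pair `u`, `u` against `v`, `v` shows that equal skeleton sizes put `u` and `v` in one
      -- orbit, as `fix` demands.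
      let g , gu≈v , _ = ∣∩∣≡⇒automorphism B u u v v ∣u∣≡∣v∣ ∣u∣≡∣v∣ ∣u∩u∣≡∣v∩v∣
      in w∈𝒮 , Orbit-≐ g {u} {v} gu≈v , λ orbits≐ →
        -- `v` lies in its own stabilizer orbit, hence in that of `u`: some `h` fixes `w` and
        -- carries `u` to `v`, so it equates the two intersection sizes.
        let h , hw≈w , hu≈v = proj₂ orbits≐ {v} (StabOrbit-refl w v)
        in ∣w∩u∣≢∣w∩v∣ (trans (sym (∣∩∣-invariant B h w u))
             (cong₂ (λ p q → ∣ p ∩ q ∣)
               (skeleton-cong B {to h w} {w} hw≈w) (skeleton-cong B {to h u} {v} hu≈v))))
  where
  open Automorphism using (to)
  ∣u∣≡∣v∣ : ∣ skeleton B u ∣ ≡ ∣ skeleton B v ∣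
  ∣u∣≡∣v∣ = trans u∈Tᵢ (sym v∈Tᵢ)
  ∣u∩u∣≡∣v∩v∣ : ∣ skeleton B u ∩ skeleton B u ∣ ≡ ∣ skeleton B v ∩ skeleton B v ∣
  ∣u∩u∣≡∣v∩v∣ = trans (cong ∣_∣ (∩-idem (skeleton B u)))
                  (trans ∣u∣≡∣v∣ (cong ∣_∣ (sym (∩-idem (skeleton B v)))))
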